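{- For every integer $k\geq 0$, there is a universal graph for $\mathcal{L}_k$ with line-width at most $4k^2+6k$, where $\mathcal{L}_k$ is the class of graphs with line-width at most $k$.
   Context: All graphs (including universal graphs) are simple and countable (the vertex set is finite or countably infinite). A graph $U$ contains a graph $G$ if a subgraph (not necessarily induced) of $U$ is isomorphic to $G$. A graph $U$ is universal for a graph class $\mathcal{G}$ if $U$ contains every graph in $\mathcal{G}$ ($U$ need not be in $\mathcal{G}$). A line-decomposition of a graph $G$ is a pair $((L,\preccurlyeq),(B_t:t\in L))$ where $L$ is a non-empty set, $\preccurlyeq$ is a total order of $L$, and the bags $B_t\subseteq V(G)$ satisfy: $\bigcup_{t\in L}B_t=V(G)$; for each $vw\in E(G)$ there is $t\in L$ with $v,w\in B_t$; and $B_{t_1}\cap B_{t_3}\subseteq B_{t_2}$ for all $t_1\preccurlyeq t_2\preccurlyeq t_3$ in $L$. Its width is $\sup_{t\in L}(|B_t|-1)$. The line-width of $G$ is the minimum width of a line-decomposition of $G$. -}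

module Defs where

open import Level using (0ℓ; suc)
open import Data.Nat.Base using (ℕ)
open import Data.Integer.Base using (ℤ; +_; _-_; _≤_; 1ℤ)
open import Data.Fin.Base using (Fin)
open import Data.Product.Base using (_×_; ∃; ∃-syntax)
open import Function.Bundles using (_↣_; _⇔_)
open import Function.Definitions using (Injective)
open import Relation.Binary.Core using (Rel; _⇒_)
open import Relation.Binary.Definitions using (Irreflexive; Symmetric)
open import Relation.Binary.Structures using (IsTotalOrder)
open import Relation.Binary.PropositionalEquality.Core using (_≡_)
open import Relation.Unary using (Pred)

-- "Finite or countably infinite" is expressed by an injection into ℕ.
record Graph : Set₁ where
  infix 4 _~_
  field
    V         : Set
    _~_       : Rel V 0ℓ
    ~-sym     : Symmetric _~_
    ~-irrefl  : Irreflexive _≡_ _~_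
    countable : V ↣ ℕ

open Graph using (V)

-- f is a bijection from A onto the subset P of B.  It is phrased with the
-- exact image of f, rather than as a bijection A ↔ ∃ P, because the elements
-- of ∃ P also carry proofs of P, which need not be unique.
_BijectsOnto_ : ∀ {A B : Set} → (A → B) → Pred B 0ℓ → Set
f BijectsOnto P = Injective _≡_ _≡_ f × (∀ y → P y ⇔ (∃[ x ] f x ≡ y))

record Subgraph (U : Graph) : Set₁ where
  open Graph U using (_~_)
  field
    vertex : Pred (V U) 0ℓ
    edge   : Rel (V U) 0ℓ
    edge-sym : Symmetric edge
    edge⇒~   : edge ⇒ _~_
    edge-end : ∀ {x y} → edge x y → vertex x × vertex y

_≅_ : ∀ {U} → Graph → Subgraph U → Set
_≅_ {U} G H = ∃[ f ] (f BijectsOnto vertex × (∀ v w → (v ~ w) ⇔ edge (f v) (f w)))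
  where
  open Graph G using (_~_)
  open Subgraph H using (vertex; edge)

_Contains_ : Graph → Graph → Set₁
U Contains G = ∃[ H ] (_≅_ {U} G H)

GraphClass : Set₂
GraphClass = Pred Graph (suc 0ℓ)

Universal : Graph → GraphClass → Set₁
Universal U 𝒢 = ∀ G → 𝒢 G → U Contains G

record LineDecomposition (G : Graph) : Set₁ where
  open Graph G using (_~_)
  infix 4 _≼_
  field
    L            : Set
    nonEmpty     : L
    _≼_          : Rel L 0ℓ
    isTotalOrder : IsTotalOrder _≡_ _≼_
    bag          : L → Pred (V G) 0ℓ
    vertex-cover : ∀ v → ∃[ t ] bag t v
    edge-cover   : ∀ {v w} → v ~ w → ∃[ t ] (bag t v × bag t w)
    convex       : ∀ {t₁ t₂ t₃} → t₁ ≼ t₂ → t₂ ≼ t₃ →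
                   ∀ {v} → bag t₁ v → bag t₃ v → bag t₂ v

HasSize : ∀ {A : Set} → Pred A 0ℓ → ℕ → Set
HasSize {A} P n = ∃[ e ] (_BijectsOnto_ {Fin n} {A} e P)

IsSupremum : Pred ℤ 0ℓ → ℤ → Set
IsSupremum S w = (∀ z → S z → z ≤ w) × (∀ u → (∀ z → S z → z ≤ u) → w ≤ u)

IsMinimum : Pred ℤ (suc 0ℓ) → ℤ → Set₁
IsMinimum S w = S w × (∀ z → S z → w ≤ z)

-- Only finite widths are recorded: a decomposition whose supremum is infinite
-- (an infinite bag, or finite bags of unbounded size) has no width w here.
-- Widths are integers because the width is -1 when all bags are empty.
HasWidth : ∀ {G} → LineDecomposition G → ℤ → Set
HasWidth D w =
    (∀ t → ∃[ n ] HasSize (bag t) n)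
  × IsSupremum (λ z → ∃[ t ] ∃[ n ] (HasSize (bag t) n × z ≡ + n - 1ℤ)) w
  where open LineDecomposition D using (bag)

-- Decompositions of infinite width do not affect a finite minimum, so a graph
-- has no line-width w here exactly when its line-width is infinite.
HasLineWidth : Graph → ℤ → Set₁
HasLineWidth G = IsMinimum (λ w → ∃[ D ] HasWidth {G} D w)

LineWidthAtMost : ℕ → GraphClass
LineWidthAtMost k G = ∃[ w ] (HasLineWidth G w × w ≤ + k)

ℒ : ℕ → GraphClass
ℒ k = LineWidthAtMost k

-- In a line-decomposition (L, bags) of depth d + 1, grow balls E₀ ⊆ E₁ ⊆ ... of L
-- from a point of a component, E₀ being that point and Eᵢ₊₁ the union of Eᵢ with
-- the intervals of all vertices that occur over Eᵢ.  A vertex first occurring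
-- over Eᵢ has level i, and its interval lies in Eᵢ₊₁.  Balls are convex, so at
-- most 2 (d + 1) vertices of level i stick out of Eᵢ (d + 1 on each side).  The
-- vertices of level j + 1 inside Eⱼ₊₁ live on points outside Eⱼ, each of which is
-- covered by a vertex of level j; hence they have depth d.  So the universal
-- object for depth d + 1 has, for every component and every j, 2 (d + 1) crossing
-- vertices and a copy of the universal object for depth d, and its bags grow by
-- 4 (d + 1).  Starting from isolated vertices for d = 1, this gives bags of size
-- at most 2 k² + 6 k + 1 for depth k + 1.
module Submission where

open import Defs
open import Axiom.ExcludedMiddle using (ExcludedMiddle)
open import Data.Nat.Base using (ℕ; _+_; _*_; _^_)
open import Data.Product.Base using (_×_; ∃-syntax)

open import Level using (0ℓ)
open import Data.Empty using (⊥-elim)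
open import Data.Fin.Base using (Fin; zero; suc; toℕ; punchIn; punchOut)
open import Data.Fin.Properties as Finₚ using (toℕ-injective; punchIn-punchOut)
open import Data.Integer.Base as ℤ using (+_; -[1+_]; 1ℤ; +≤+)
import Data.Integer.Properties as ℤ
open import Data.Nat.Base using (zero; suc; _∸_; _≤_; z≤n; s≤s)
open import Data.Nat.Properties
open import Data.Nat.Solver using (module +-*-Solver)
open import Data.Product.Base using (_,_; proj₁; proj₂; ∃; Σ-syntax)
open import Data.Product.Relation.Binary.Lex.NonStrict using (×-Lex; ×-isTotalOrder)
open import Data.Product.Relation.Binary.Pointwise.NonDependent using (≡×≡⇒≡; ≡⇒≡×≡)
open import Data.Sum.Base using (_⊎_; inj₁; inj₂; [_,_]′)
open import Data.Sum.Properties using (inj₁-injective; inj₂-injective)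
open import Data.Unit.Base using (tt)
open import Function.Base using (_∘_; id; flip)
open import Function.Bundles using (mk⇔; mk↣; Injection; Equivalence; _↣_)
open import Function.Definitions using (Injective)
open import Relation.Binary.Core using (Rel)
open import Relation.Binary.Definitions using (Total; Transitive)
open import Relation.Binary.PropositionalEquality
  using (_≡_; _≢_; refl; sym; trans; cong; subst; subst₂; ≢-sym; isEquivalence)
open import Relation.Binary.Structures using (IsTotalOrder)
open import Relation.Nullary using (¬_; yes; no)
open import Relation.Nullary.Decidable using (decidable-stable)
open import Relation.Unary using (Pred; _∈_; _∉_; _⊆_; _∩_; _∪_; U; ∅; ⋃)

private
  variable
    A B : Set
    P Q : Pred A 0ℓ
    m n : ℕ

-- Cardinality bounds

infixl 6 _∖_

_∖_ : Pred A 0ℓ → A → Pred A 0ℓ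
(P ∖ x) y = P y × y ≢ x

-- Counts by deleting members rather than listing them, so bounds pass to subsets, images and
-- directed unions by induction.
AtMost : ℕ → Pred A 0ℓ → Set
AtMost zero    P = ∀ x → x ∉ P
AtMost (suc n) P = ∀ x → x ∈ P → AtMost n (P ∖ x)

atMost-⊆ : ∀ n → P ⊆ Q → AtMost n Q → AtMost n P
atMost-⊆ zero    P⊆Q h x x∈P = h x (P⊆Q x∈P)
atMost-⊆ (suc n) P⊆Q h x x∈P =
  atMost-⊆ n (λ (y∈P , y≢x) → P⊆Q y∈P , y≢x) (h x (P⊆Q x∈P))

atMost-∪ : ∀ m n → AtMost m P → AtMost n Q → AtMost (m + n) (P ∪ Q)
atMost-∪ zero n hP hQ = atMost-⊆ n [ ⊥-elim ∘ hP _ , id ]′ hQ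
atMost-∪ {P = P} {Q = Q} m@(suc _) zero hP hQ =
  subst (λ l → AtMost l (P ∪ Q)) (sym (+-identityʳ m))
    (atMost-⊆ m [ id , ⊥-elim ∘ hQ _ ]′ hP)
atMost-∪ (suc m) (suc n) hP hQ x (inj₁ x∈P) =
  atMost-⊆ (m + suc n) (λ { (inj₁ y∈P , y≢x) → inj₁ (y∈P , y≢x)
                          ; (inj₂ y∈Q , _) → inj₂ y∈Q })
    (atMost-∪ m (suc n) (hP x x∈P) hQ)
atMost-∪ {P = P} {Q = Q} (suc m) (suc n) hP hQ x (inj₂ x∈Q) =
  subst (λ l → AtMost l ((P ∪ Q) ∖ x)) (sym (+-suc m n))
    (atMost-⊆ (suc m + n) (λ { (inj₁ y∈P , _) → inj₁ y∈P
                             ; (inj₂ y∈Q , y≢x) → inj₂ (y∈Q , y≢x) })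
      (atMost-∪ (suc m) n hP (hQ x x∈Q)))

atMost-∅ : ∀ n → AtMost {A} n ∅
atMost-∅ zero    _ ()
atMost-∅ (suc n) _ ()

atMost-≤ : m ≤ n → AtMost m P → AtMost n P
atMost-≤ {m = m} {n = n} {P = P} m≤n h =
  subst (λ l → AtMost l P) (m+[n∸m]≡n m≤n)
    (atMost-⊆ (m + (n ∸ m)) inj₁ (atMost-∪ m (n ∸ m) h (atMost-∅ (n ∸ m))))

Image : (A → B) → Pred A 0ℓ → Pred B 0ℓ
Image f P y = ∃[ x ] (P x × f x ≡ y)

atMost-image : ∀ n (f : A → B) → AtMost n P → AtMost n (Image f P)
atMost-image zero    f h _ (x , x∈P , _) = h x x∈P
atMost-image (suc n) f h _ (x , x∈P , refl) =
  atMost-⊆ n (λ { ((z , z∈P , refl) , fz≢fx) → z , (z∈P , fz≢fx ∘ cong f) , refl })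
    (atMost-image n f (h x x∈P))

atMost-Fin : ∀ n → AtMost {Fin n} n U
atMost-Fin zero    ()
atMost-Fin (suc n) x _ =
  atMost-⊆ n (λ (_ , y≢x) → punchOut (≢-sym y≢x) , _ , punchIn-punchOut (≢-sym y≢x))
    (atMost-image n (punchIn x) (atMost-Fin n))

-- After `x` is deleted, the sets `Q t` that contained `x` are still directed and exhaust the rest
-- of the union, and each has lost a member; induction applies to them.
atMost-directed : ∀ n {T : Set} (Q : T → Pred A 0ℓ) →
                  (∀ s t → ∃[ u ] (Q s ⊆ Q u × Q t ⊆ Q u)) →
                  (∀ t → AtMost n (Q t)) → AtMost n (⋃ T Q)
atMost-directed zero    Q dir h x (t , x∈Qt) = h t x x∈Qt
atMost-directed (suc n) {T} Q dir h x (t₀ , x∈Qt₀) =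
  atMost-⊆ n
    (λ ((t , y∈Qt) , y≢x) → let u , t₀⊆u , t⊆u = dir t₀ t
                            in (u , t₀⊆u x∈Qt₀) , t⊆u y∈Qt , y≢x)
    (atMost-directed n {∃[ t ] Q t x} (λ (t , _) → Q t ∖ x)
      (λ (s , x∈Qs) (t , _) →
        let u , s⊆u , t⊆u = dir s t
        in (u , s⊆u x∈Qs) , (λ (y∈ , y≢x) → s⊆u y∈ , y≢x) , (λ (y∈ , y≢x) → t⊆u y∈ , y≢x))
      (λ (t , x∈Qt) → h t x x∈Qt))

hasSize⇒atMost : HasSize P n → AtMost n P
hasSize⇒atMost {n = n} (e , _ , onto) =
  atMost-⊆ n (λ x∈P → let i , ei≡x = Equivalence.to (onto _) x∈P in i , _ , ei≡x)
    (atMost-image n e (atMost-Fin n))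

atMost-injection : ∀ m n (e : Fin n → A) → Injective _≡_ _≡_ e → (∀ i → P (e i)) →
                   AtMost m P → n ≤ m
atMost-injection m       zero    e inj e∈P h = z≤n
atMost-injection zero    (suc n) e inj e∈P h = ⊥-elim (h _ (e∈P zero))
atMost-injection (suc m) (suc n) e inj e∈P h =
  s≤s (atMost-injection m n (e ∘ suc) (λ eq → Finₚ.suc-injective (inj eq))
        (λ i → e∈P (suc i) , λ eq → Finₚ.0≢1+n (sym (inj eq))) (h _ (e∈P zero)))

hasSize-≤ : ∀ m → HasSize P n → AtMost m P → n ≤ m
hasSize-≤ m (e , inj , onto) =
  atMost-injection m _ e inj (λ i → Equivalence.from (onto _) (i , refl))

-- Countability

-- This is 2^a (2b + 1), so `a` and `b` are recovered by parity and halving.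
pair : ℕ → ℕ → ℕ
pair zero    b = suc (2 * b)
pair (suc a) b = 2 * pair a b

pair-injective : ∀ a b a′ b′ → pair a b ≡ pair a′ b′ → a ≡ a′ × b ≡ b′
pair-injective zero    b zero     b′ eq = refl , *-cancelˡ-≡ b b′ 2 (suc-injective eq)
pair-injective zero    b (suc a′) b′ eq = ⊥-elim (even≢odd (pair a′ b′) b (sym eq))
pair-injective (suc a) b zero     b′ eq = ⊥-elim (even≢odd (pair a b) b′ eq)
pair-injective (suc a) b (suc a′) b′ eq =
  let a≡a′ , b≡b′ = pair-injective a b a′ b′ (*-cancelˡ-≡ (pair a b) (pair a′ b′) 2 eq)
  in cong suc a≡a′ , b≡b′

×-countable : A ↣ ℕ → B ↣ ℕ → (A × B) ↣ ℕ
×-countable f g = mk↣ {to = λ (a , b) → pair (F.to a) (G.to b)} λ {(a , b)} {(a′ , b′)} eq →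
  let p , q = pair-injective (F.to a) (G.to b) (F.to a′) (G.to b′) eq
  in ≡×≡⇒≡ (F.injective p , G.injective q)
  where module F = Injection f
        module G = Injection g

⊎-countable : A ↣ ℕ → B ↣ ℕ → (A ⊎ B) ↣ ℕ
⊎-countable f g = mk↣ {to = [ pair 0 ∘ F.to , pair 1 ∘ G.to ]′} λ
  { {inj₁ x} {inj₁ y} eq → cong inj₁ (F.injective (proj₂ (pair-injective 0 (F.to x) 0 (F.to y) eq)))
  ; {inj₁ x} {inj₂ y} eq → ⊥-elim (0≢1+n (proj₁ (pair-injective 0 (F.to x) 1 (G.to y) eq)))
  ; {inj₂ x} {inj₁ y} eq → ⊥-elim (0≢1+n (sym (proj₁ (pair-injective 1 (G.to x) 0 (F.to y) eq))))
  ; {inj₂ x} {inj₂ y} eq → cong inj₂ (G.injective (proj₂ (pair-injective 1 (G.to x) 1 (G.to y) eq))) }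
  where module F = Injection f
        module G = Injection g

ℕ-countable : ℕ ↣ ℕ
ℕ-countable = mk↣ {to = id} id

-- Lexicographic products with ℕ

module Lex {L : Set} {_≼_ : Rel L 0ℓ} (isTotalOrder : IsTotalOrder _≡_ _≼_) where
  open IsTotalOrder isTotalOrder using (reflexive)

  infix 4 _⊑_

  _⊑_ : Rel (ℕ × L) 0ℓ
  _⊑_ = ×-Lex _≡_ _≤_ _≼_

  ⊑-isTotalOrder : IsTotalOrder _≡_ _⊑_
  ⊑-isTotalOrder = record
    { isPartialOrder = record
      { isPreorder = record
        { isEquivalence = isEquivalence
        ; reflexive = λ eq → P.reflexive (≡⇒≡×≡ eq)
        ; trans = P.trans }
      ; antisym = λ p q → ≡×≡⇒≡ (P.antisym p q) }
    ; total = P.total }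
    where module P = IsTotalOrder (×-isTotalOrder _≟_ ≤-isTotalOrder isTotalOrder)

  ⊑⇒≤ : ∀ {x y} → x ⊑ y → proj₁ x ≤ proj₁ y
  ⊑⇒≤ (inj₁ (a≤a′ , _)) = a≤a′
  ⊑⇒≤ (inj₂ (refl , _)) = ≤-refl

  ⊑⇒≼ : ∀ {a s t} → (a , s) ⊑ (a , t) → s ≼ t
  ⊑⇒≼ (inj₁ (_ , a≢a)) = ⊥-elim (a≢a refl)
  ⊑⇒≼ (inj₂ (_ , s≼t)) = s≼t

  ⊑-between : ∀ {a b s t u} → (a , s) ⊑ (b , t) → (b , t) ⊑ (a , u) →
              a ≡ b × s ≼ t × t ≼ u
  ⊑-between p q with refl ← ≤-antisym (⊑⇒≤ p) (⊑⇒≤ q) = refl , ⊑⇒≼ p , ⊑⇒≼ q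

-- Interval models and their layered products

-- A decomposition given before its graph: `graph` takes every edge that the bags allow, so an
-- injection into it only has to preserve sharing a bag.
record IntervalModel : Set₁ where
  infix 4 _≼_
  field
    V            : Set
    countable    : V ↣ ℕ
    L            : Set
    nonEmpty     : L
    _≼_          : Rel L 0ℓ
    isTotalOrder : IsTotalOrder _≡_ _≼_
    bag          : L → Pred V 0ℓ
    vertex-cover : ∀ v → ∃[ t ] bag t v
    convex       : ∀ {t₁ t₂ t₃} → t₁ ≼ t₂ → t₂ ≼ t₃ →
                   ∀ {v} → bag t₁ v → bag t₃ v → bag t₂ v

  graph : Graph
  graph = record
    { V         = V
    ; _~_       = λ v w → v ≢ w × ∃[ t ] (bag t v × bag t w)
    ; ~-sym     = λ (v≢w , t , v∈t , w∈t) → ≢-sym v≢w , t , w∈t , v∈t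
    ; ~-irrefl  = λ v≡w (v≢w , _) → v≢w v≡w
    ; countable = countable }

  decomposition : LineDecomposition graph
  decomposition = record
    { L = L ; nonEmpty = nonEmpty ; _≼_ = _≼_ ; isTotalOrder = isTotalOrder
    ; bag = bag ; vertex-cover = vertex-cover ; edge-cover = proj₂ ; convex = convex }

module Layered (m : ℕ) (M : IntervalModel) where
  open IntervalModel M
  module Lex₁ = Lex isTotalOrder
  module Lex₂ = Lex Lex₁.⊑-isTotalOrder

  Vertex : Set
  Vertex = ℕ × ℕ × (V ⊎ Fin m)

  -- The crossing vertices of level i separate layer i - 1 from layer i of the
  -- same component; those of level 0 only occur in layer 0.
  layerBag : ℕ × ℕ × L → Pred Vertex 0ℓ
  layerBag (n , j , t) (n′ , i , inj₁ v) = n ≡ n′ × j ≡ i × bag t v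
  layerBag (n , j , t) (n′ , i , inj₂ _) = n ≡ n′ × j ≤ i × i ≤ suc j

  layered-convex : ∀ {t₁ t₂ t₃} → t₁ Lex₂.⊑ t₂ → t₂ Lex₂.⊑ t₃ →
                   ∀ {v} → layerBag t₁ v → layerBag t₃ v → layerBag t₂ v
  layered-convex p q {_ , _ , inj₁ _} (refl , refl , b) (refl , refl , b′)
    with refl , p′ , q′ ← Lex₂.⊑-between p q
    with refl , p″ , q″ ← Lex₁.⊑-between p′ q′
    = refl , refl , convex p″ q″ b b′
  layered-convex p q {_ , _ , inj₂ _} (refl , _ , i≤1+j₁) (refl , j₃≤i , _)
    with refl , p′ , q′ ← Lex₂.⊑-between p q
    -- Layers grow along the order: the bound `j ≤ i` comes from the right end, `i ≤ suc j` from the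
    -- left end.
    = refl , ≤-trans (Lex₁.⊑⇒≤ q′) j₃≤i , ≤-trans i≤1+j₁ (s≤s (Lex₁.⊑⇒≤ p′))

  layered : IntervalModel
  layered = record
    { V = Vertex
    ; countable = ×-countable ℕ-countable (×-countable ℕ-countable
                    (⊎-countable countable (mk↣ toℕ-injective)))
    ; L = ℕ × ℕ × L
    ; nonEmpty = 0 , 0 , nonEmpty
    ; _≼_ = Lex₂._⊑_
    ; isTotalOrder = Lex₂.⊑-isTotalOrder
    ; bag = layerBag
    ; vertex-cover = λ
      { (n , i , inj₁ v) → let t , v∈t = vertex-cover v in (n , i , t) , refl , refl , v∈t
      ; (n , i , inj₂ _) → (n , i , nonEmpty) , refl , ≤-refl , n≤1+n i }
    ; convex = layered-convex }

  -- Over layer `j` of a component lie one bag of `M` and the crossing vertices of the two levels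
  -- `j` and `suc j`.
  layered-size : ∀ {b} → (∀ t → AtMost b (bag t)) → ∀ t → AtMost (b + (m + m)) (layerBag t)
  layered-size {b} size (n , j , t) =
    atMost-⊆ (b + (m + m)) split
      (atMost-∪ b (m + m) (atMost-image b _ (size t))
        (atMost-∪ m m (level j) (level (suc j))))
    where
    crossing : ℕ → Fin m → Vertex
    crossing i c = n , i , inj₂ c
    level : ∀ i → AtMost m (Image (crossing i) U)
    level i = atMost-image m (crossing i) (atMost-Fin m)
    split : layerBag (n , j , t) ⊆
            Image (λ v → n , j , inj₁ v) (bag t) ∪
            (Image (crossing j) U ∪ Image (crossing (suc j)) U)
    split {_ , _ , inj₁ v} (refl , refl , v∈t) = inj₁ (v , v∈t , refl)
    split {_ , i , inj₂ c} (refl , j≤i , i≤1+j) with m≤n⇒m<n∨m≡n j≤i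
    ... | inj₂ refl = inj₂ (inj₁ (c , _ , refl))
    ... | inj₁ j<i with refl ← ≤-antisym j<i i≤1+j = inj₂ (inj₂ (c , _ , refl))

-- Universal models and their bag sizes

isolated : IntervalModel
isolated = record
  { V = ℕ ; countable = ℕ-countable ; L = ℕ ; nonEmpty = 0 ; _≼_ = _≤_
  ; isTotalOrder = ≤-isTotalOrder ; bag = _≡_ ; vertex-cover = λ v → v , refl
  ; convex = λ { p q refl refl → ≤-antisym q p } }

-- Index `k` serves depth `k + 1`; the step reaches depth `k + 2`, which is the number of crossing
-- vertices on each side of a ball.
universalModel : ℕ → IntervalModel
universalModel zero    = isolated
universalModel (suc k) =
  Layered.layered (suc (suc k) + suc (suc k)) (universalModel k)

bagBound : ℕ → ℕ
bagBound zero    = 1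
bagBound (suc k) =
  bagBound k + ((suc (suc k) + suc (suc k)) + (suc (suc k) + suc (suc k)))

universalModel-size : ∀ k t → AtMost (bagBound k) (IntervalModel.bag (universalModel k) t)
universalModel-size zero    t x refl y (y≡x , y≢x) = y≢x (sym y≡x)
universalModel-size (suc k) =
  Layered.layered-size (suc (suc k) + suc (suc k)) (universalModel k) (universalModel-size k)

bagBound-≡ : ∀ k → bagBound k ≡ suc (2 * k ^ 2 + 6 * k)
bagBound-≡ zero    = refl
bagBound-≡ (suc k) rewrite bagBound-≡ k = solve 1
  (λ k → let s = con 2 :+ k in
    con 1 :+ (con 2 :* k :^ 2 :+ con 6 :* k) :+ ((s :+ s) :+ (s :+ s))
    := con 1 :+ (con 2 :* (con 1 :+ k) :^ 2 :+ con 6 :* (con 1 :+ k))) refl k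
  where open +-*-Solver

bagBound-≤ : ∀ k → bagBound k ≤ suc (4 * k ^ 2 + 6 * k)
bagBound-≤ k rewrite bagBound-≡ k =
  s≤s (+-monoˡ-≤ (6 * k) {2 * k ^ 2} {4 * k ^ 2} (*-monoˡ-≤ (k ^ 2) {2} {4} (s≤s (s≤s z≤n))))

-- Relative to a subset `S`, so that the recursion can embed the inner vertices alone over the same
-- line and bags.
record Embedding {V : Set} {L : Set} (bag : L → Pred V 0ℓ) (S : Pred V 0ℓ)
                 (M : IntervalModel) : Set where
  module M = IntervalModel M
  field
    at        : ∀ {v} → S v → M.V
    injective : ∀ {v w} (p : S v) (q : S w) → at p ≡ at q → v ≡ w
    meets     : ∀ {v w} (p : S v) (q : S w) {t} → bag t v → bag t w →
                ∃[ u ] (M.bag u (at p) × M.bag u (at q))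

Numbering : ℕ → Pred A 0ℓ → Set
Numbering m P = Σ[ f ∈ (∀ {x} → P x → Fin m) ]
  (∀ {x y} (p : P x) (q : P y) → f p ≡ f q → x ≡ y)

-- Minima, numberings and sizes by excluded middle

module _ (em : ∀ {ℓ} → ExcludedMiddle ℓ) where

  least : ∀ {ℓ} (P : Pred ℕ ℓ) {n} → P n → ∃[ m ] (P m × (∀ j → P j → m ≤ j))
  least P {n} Pn with em {P = P 0}
  least P {n}     Pn | yes P0 = 0 , P0 , λ _ _ → z≤n
  least P {zero}  P0 | no ¬P0 = ⊥-elim (¬P0 P0)
  least P {suc n} Pn | no ¬P0 =
    let m , Pm , min = least (P ∘ suc) Pn
    in suc m , Pm , λ { zero P0 → ⊥-elim (¬P0 P0) ; (suc j) Pj → s≤s (min j Pj) }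

  numbering : ∀ m {P : Pred A 0ℓ} → AtMost m P → Numbering m P
  numbering {A} zero    {P} h = f , λ p → ⊥-elim (h _ p)
    where
    f : ∀ {x} → P x → Fin 0
    f p = ⊥-elim (h _ p)
  numbering {A} (suc m) {P} h with em {P = ∃ P}
  ... | no ¬P = (λ {_} _ → zero) , λ p → ⊥-elim (¬P (_ , p))
  ... | yes (x₀ , p₀) = f , f-injective
    where
    rec = numbering m (h x₀ p₀)
    f : ∀ {x} → P x → Fin (suc m)
    f {x} p with em {P = x ≡ x₀}
    ... | yes _    = zero
    ... | no x≢x₀ = suc (proj₁ rec (p , x≢x₀))
    f-injective : ∀ {x y} (p : P x) (q : P y) → f p ≡ f q → x ≡ y
    f-injective {x} {y} p q eq with em {P = x ≡ x₀} | em {P = y ≡ x₀}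
    ... | yes refl | yes refl = refl
    ... | no _     | no _     = proj₂ rec _ _ (Finₚ.suc-injective eq)

  atMost⇒hasSize : ∀ m {P : Pred A 0ℓ} → AtMost m P → ∃[ n ] HasSize P n
  atMost⇒hasSize m {P} h with em {P = ∃ P}
  ... | no ¬P = 0 , (λ ()) , (λ { {()} }) , λ y → mk⇔ (λ p → ⊥-elim (¬P (y , p))) λ ()
  atMost⇒hasSize zero    h | yes (x , p) = ⊥-elim (h x p)
  atMost⇒hasSize {A} (suc m) {P} h | yes (x , p)
    with n , e , inj , onto ← atMost⇒hasSize m (h x p) =
    suc n , e′ , inj′ , λ y → mk⇔ (to y) (λ { (i , refl) → from i })
    where
    e′ : Fin (suc n) → A
    e′ zero    = x
    e′ (suc i) = e i
    e-∈ : ∀ i → (P ∖ x) (e i)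
    e-∈ i = Equivalence.from (onto _) (i , refl)
    inj′ : Injective _≡_ _≡_ e′
    inj′ {zero}  {zero}  _  = refl
    inj′ {zero}  {suc j} eq = ⊥-elim (proj₂ (e-∈ j) (sym eq))
    inj′ {suc i} {zero}  eq = ⊥-elim (proj₂ (e-∈ i) eq)
    inj′ {suc i} {suc j} eq = cong suc (inj eq)
    from : ∀ i → P (e′ i)
    from zero    = p
    from (suc i) = proj₁ (e-∈ i)
    to : ∀ y → P y → ∃[ i ] e′ i ≡ y
    to y q with em {P = y ≡ x}
    ... | yes refl = zero , refl
    ... | no y≢x = let i , eq = Equivalence.to (onto y) (q , y≢x) in suc i , eq

  -- Widths

  private
    +n≤ : ∀ {n u} → + n ℤ.- 1ℤ ℤ.≤ u → + n ℤ.≤ u ℤ.+ 1ℤ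
    +n≤ {n} {u} p = subst (ℤ._≤ u ℤ.+ 1ℤ) (cancel (+ n)) (ℤ.+-monoˡ-≤ 1ℤ p)
      where
      cancel : ∀ z → (z ℤ.- 1ℤ) ℤ.+ 1ℤ ≡ z
      cancel z = trans (ℤ.+-assoc z (ℤ.- 1ℤ) 1ℤ) (ℤ.+-identityʳ z)

    ≤u : ∀ {n u} → + n ℤ.≤ u ℤ.+ 1ℤ → + n ℤ.- 1ℤ ℤ.≤ u
    ≤u {n} {u} p = subst (+ n ℤ.- 1ℤ ℤ.≤_)
      (trans (ℤ.+-assoc u 1ℤ (ℤ.- 1ℤ)) (ℤ.+-identityʳ u)) (ℤ.+-monoˡ-≤ (ℤ.- 1ℤ) p)

  hasWidth : ∀ {G} (D : LineDecomposition G) b →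
             (∀ t → AtMost b (LineDecomposition.bag D t)) →
             ∃[ n ] (n ≤ b × HasWidth D (+ n ℤ.- 1ℤ))
  hasWidth D b size = width , width≤b , sizes , upper , lower
    where
    open LineDecomposition D using (bag; nonEmpty)
    sizes : ∀ t → ∃[ n ] HasSize (bag t) n
    sizes t = atMost⇒hasSize b (size t)
    Upper : Pred ℕ 0ℓ
    Upper u = ∀ t n → HasSize (bag t) n → n ≤ u
    sup = least Upper {b} (λ t n s → hasSize-≤ b s (size t))
    width = proj₁ sup
    width≤b : width ≤ b
    width≤b = proj₂ (proj₂ sup) b (λ t n s → hasSize-≤ b s (size t))
    upper : ∀ z → ∃[ t ] ∃[ n ] (HasSize (bag t) n × z ≡ + n ℤ.- 1ℤ) → z ℤ.≤ + width ℤ.- 1ℤ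
    upper _ (t , n , s , refl) = ℤ.+-monoˡ-≤ (ℤ.- 1ℤ) (+≤+ (proj₁ (proj₂ sup) t n s))
    lower : ∀ u → (∀ z → ∃[ t ] ∃[ n ] (HasSize (bag t) n × z ≡ + n ℤ.- 1ℤ) → z ℤ.≤ u) →
            + width ℤ.- 1ℤ ℤ.≤ u
    lower u u-upper = ≤u (go (u ℤ.+ 1ℤ) (λ t n s → +n≤ (u-upper _ (t , n , s , refl))))
      where
      go : ∀ u′ → (∀ t n → HasSize (bag t) n → + n ℤ.≤ u′) → + width ℤ.≤ u′
      go (+ a)    ub = +≤+ (proj₂ (proj₂ sup) a (λ t n s → ℤ.drop‿+≤+ (ub t n s)))
      -- A negative bound contradicts the size of the bag at `nonEmpty`.
      go -[1+ a ] ub with () ← ub nonEmpty _ (proj₂ (sizes nonEmpty))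

  -- Some bag exists, so every width is at least -1 and has the form `n - 1` with `n` natural; the
  -- least such `n` gives the minimum.
  lineWidthAtMost : ∀ {G} (D : LineDecomposition G) k →
                    (∀ t → AtMost (suc k) (LineDecomposition.bag D t)) →
                    LineWidthAtMost k G
  lineWidthAtMost {G} D k size =
    + width ℤ.- 1ℤ , (proj₁ (proj₂ min) , minimal) ,
    ≤u (ℤ.≤-trans (+≤+ width≤1+k) (ℤ.≤-reflexive (cong +_ (sym (+-comm k 1)))))
    where
    Achieved : Pred ℕ _
    Achieved n = ∃[ D′ ] HasWidth {G} D′ (+ n ℤ.- 1ℤ)
    w = hasWidth D (suc k) size
    min = least Achieved {proj₁ w} (D , proj₂ (proj₂ w))
    width = proj₁ min
    width≤1+k : width ≤ suc k
    width≤1+k = ≤-trans (proj₂ (proj₂ min) (proj₁ w) (D , proj₂ (proj₂ w))) (proj₁ (proj₂ w))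
    minimal : ∀ z → ∃[ D′ ] HasWidth {G} D′ z → + width ℤ.- 1ℤ ℤ.≤ z
    minimal z (D′ , hw@(sizes , upper , _)) = ≤u (go (z ℤ.+ 1ℤ) refl)
      where
      t₀ = LineDecomposition.nonEmpty D′
      0≤1+z : + 0 ℤ.≤ z ℤ.+ 1ℤ
      0≤1+z = ℤ.≤-trans (+≤+ z≤n) (+n≤ {proj₁ (sizes t₀)} (upper _ (t₀ , _ , proj₂ (sizes t₀) , refl)))
      go : ∀ y → z ℤ.+ 1ℤ ≡ y → + width ℤ.≤ y
      go (+ a) eq = +≤+ (proj₂ (proj₂ min) a (D′ , subst (HasWidth D′) z≡ hw))
        where
        z≡ : z ≡ + a ℤ.- 1ℤ
        z≡ = trans (sym (trans (ℤ.+-assoc z 1ℤ (ℤ.- 1ℤ)) (ℤ.+-identityʳ z)))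
                   (cong (ℤ._- 1ℤ) eq)
      go -[1+ a ] eq with () ← subst (+ 0 ℤ.≤_) eq 0≤1+z

  lineWidthAtMost⁻¹ : ∀ {G} k → LineWidthAtMost k G →
                      ∃[ D ] (∀ t → AtMost (suc k) (LineDecomposition.bag {G} D t))
  lineWidthAtMost⁻¹ k (w , ((D , sizes , upper , _) , _) , w≤k) = D , λ t →
    let n , s = sizes t
        n≤1+k = ℤ.drop‿+≤+ (ℤ.≤-trans (+n≤ (ℤ.≤-trans (upper _ (t , n , s , refl)) w≤k))
                                        (ℤ.≤-reflexive (cong +_ (+-comm k 1))))
    in atMost-≤ n≤1+k (hasSize⇒atMost s)

  -- Balls, levels and the embedding

  module _ {G : Graph} (D : LineDecomposition G) where
    open Graph G using (V; countable)
    open LineDecomposition D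
    open IsTotalOrder isTotalOrder using (total; antisym)
      renaming (trans to ≼-trans; refl to ≼-refl)
    open Injection countable using () renaming (to to code; injective to code-injective)

    Hits : Pred L 0ℓ → Pred V 0ℓ
    Hits E v = ∃[ t ] (E t × bag t v)

    Convex : Pred L 0ℓ → Set
    Convex E = ∀ {t₁ t₂ t₃} → t₁ ≼ t₂ → t₂ ≼ t₃ → E t₁ → E t₃ → E t₂

    -- Vertices over `x` that do not end inside `E` in the direction of `_⊑_`; `_≼_` and `flip _≼_`
    -- give the two sides of a ball.
    Saturated : Rel L 0ℓ → Pred L 0ℓ → L → Pred V 0ℓ
    Saturated _⊑_ E x v = bag x v × (∀ {z} → E z → x ⊑ z → bag z v)

    -- Moving `x` forward within `E` only enlarges its set of saturated vertices, so these sets form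
    -- a chain, and each lies within one bag.
    atMost-saturated : ∀ {_⊑_ : Rel L 0ℓ} → Total _⊑_ → Transitive _⊑_ →
                       ∀ {S : Pred V 0ℓ} n → (∀ t → AtMost n (S ∩ bag t)) → ∀ E →
                       AtMost n (⋃ (∃ E) (λ (x , _) → S ∩ Saturated _⊑_ E x))
    atMost-saturated {_⊑_} ⊑-total ⊑-trans {S} n depth E =
      atMost-directed n _ directed
        (λ (t , _) → atMost-⊆ n (λ (Sv , v∈t , _) → Sv , v∈t) (depth t))
      where
      grow : ∀ {s t} → E t → s ⊑ t → S ∩ Saturated _⊑_ E s ⊆ S ∩ Saturated _⊑_ E t
      grow Et s⊑t (Sv , _ , sat) = Sv , sat Et s⊑t , λ Ez t⊑z → sat Ez (⊑-trans s⊑t t⊑z)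
      directed : ∀ (s t : ∃ E) → ∃[ u ]
        (S ∩ Saturated _⊑_ E (proj₁ s) ⊆ S ∩ Saturated _⊑_ E (proj₁ u) ×
         S ∩ Saturated _⊑_ E (proj₁ t) ⊆ S ∩ Saturated _⊑_ E (proj₁ u))
      directed (s , Es) (t , Et) with ⊑-total s t
      ... | inj₁ s⊑t = (t , Et) , grow Et s⊑t , id
      ... | inj₂ t⊑s = (s , Es) , id , grow Es t⊑s

    module Layers (S : Pred V 0ℓ) where

      -- The first argument is the code of the vertex at whose chosen point the
      -- ball is centred; the ball is empty if no vertex of S has that code.
      Ball : ℕ → ℕ → Pred L 0ℓ
      Ball n zero    t = ∃[ w ] (S w × code w ≡ n × proj₁ (vertex-cover w) ≡ t)
      Ball n (suc i) t = Ball n i t ⊎ ∃[ v ] (S v × Hits (Ball n i) v × bag t v)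

      Ball₀-unique : ∀ {n s t} → Ball n 0 s → Ball n 0 t → s ≡ t
      Ball₀-unique (v , _ , p , refl) (w , _ , q , refl) =
        cong (λ u → proj₁ (vertex-cover u)) (code-injective (trans p (sym q)))

      -- A new point is joined to the old ball along the interval of the vertex that added it, which
      -- lies in the new ball; for an old point the segment is trivial.
      Ball-spread : ∀ n i {t} → Ball n (suc i) t → ∃[ x ] (Ball n i x ×
                    (∀ {s} → (t ≼ s × s ≼ x) ⊎ (x ≼ s × s ≼ t) → Ball n (suc i) s))
      Ball-spread n i {t} (inj₁ b) = t , b ,
        λ { (inj₁ (p , q)) → inj₁ (subst (Ball n i) (antisym p q) b)
          ; (inj₂ (p , q)) → inj₁ (subst (Ball n i) (antisym p q) b) }
      Ball-spread n i {t} (inj₂ (v , Sv , h@(x , b , v∈x) , v∈t)) = x , b ,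
        λ { (inj₁ (p , q)) → inj₂ (v , Sv , h , convex p q v∈t v∈x)
          ; (inj₂ (p , q)) → inj₂ (v , Sv , h , convex p q v∈x v∈t) }

      -- Join the ends to points `x₁` and `x₃` of the previous ball. Then `t₂` lies on one of the
      -- joining segments, or between `x₁` and `x₃`, where induction applies.
      Ball-convex : ∀ n i → Convex (Ball n i)
      Ball-convex n zero {t₁} p q b₁ b₃ with refl ← Ball₀-unique b₁ b₃ =
        subst (Ball n 0) (antisym p q) b₁
      Ball-convex n (suc i) {t₁} {t₂} {t₃} p q b₁ b₃
        with x₁ , e₁ , f₁ ← Ball-spread n i b₁ | x₃ , e₃ , f₃ ← Ball-spread n i b₃
        with total t₂ x₁ | total t₂ x₃
      ... | inj₁ t₂≼x₁ | _           = f₁ (inj₁ (p , t₂≼x₁))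
      ... | inj₂ x₁≼t₂ | inj₂ x₃≼t₂  = f₃ (inj₂ (x₃≼t₂ , q))
      ... | inj₂ x₁≼t₂ | inj₁ t₂≼x₃  = inj₁ (Ball-convex n i x₁≼t₂ t₂≼x₃ e₁ e₃)

      Level : ℕ → ℕ → Pred V 0ℓ
      Level n i v = Hits (Ball n i) v × (∀ j → Hits (Ball n j) v → i ≤ j)

      -- Level 0 is counted as crossing altogether: no smaller ball exists to
      -- reduce the depth, but all its vertices contain the single point of E₀.
      Cross : ℕ → ℕ → Pred V 0ℓ
      Cross n i v = S v × Level n i v × (i ≡ 0 ⊎ ∃[ t ] (bag t v × ¬ Ball n i t))

      -- The index lags one behind the level: these vertices fill layer `j`, between the crossing
      -- levels `j` and `suc j`.
      Inner : ℕ → ℕ → Pred V 0ℓ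
      Inner n j v = S v × Level n (suc j) v × (∀ t → bag t v → Ball n (suc j) t)

      -- Components are named by the least code from which they are reached.
      Root : ℕ → Pred V 0ℓ
      Root n v = (∃[ i ] Hits (Ball n i) v) × (∀ m → ∃[ i ] Hits (Ball m i) v → n ≤ m)

      hits-next : ∀ {n i v t} → S v → Hits (Ball n i) v → bag t v → Ball n (suc i) t
      hits-next Sv h v∈t = inj₂ (_ , Sv , h , v∈t)

      -- A vertex over `x` that leaves the ball at `y` covers the ball from `x` on towards that
      -- side, so it is saturated there; each side contributes at most `d`.
      atMost-cross : ∀ d → (∀ t → AtMost d (S ∩ bag t)) → ∀ n i → AtMost (d + d) (Cross n i)
      atMost-cross d depth n i =
        atMost-⊆ (d + d) split
          (atMost-∪ d d
            (atMost-saturated {_≼_} total ≼-trans d depth (Ball n i))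
            (atMost-saturated {flip _≼_} (flip total) (flip ≼-trans) d depth (Ball n i)))
        where
        split : Cross n i ⊆ ⋃ (∃ (Ball n i)) (λ (x , _) → S ∩ Saturated _≼_ (Ball n i) x) ∪
                            ⋃ (∃ (Ball n i)) (λ (x , _) → S ∩ Saturated (flip _≼_) (Ball n i) x)
        split (Sv , ((x , bx , v∈x) , _) , inj₁ refl) =
          inj₁ ((x , bx) , Sv , v∈x ,
                λ bz _ → subst (λ z → bag z _) (Ball₀-unique bx bz) v∈x)
        split (Sv , ((x , bx , v∈x) , _) , inj₂ (y , v∈y , y∉)) with total x y
        ... | inj₁ x≼y = inj₁ ((x , bx) , Sv , v∈x , λ {z} bz x≼z →
          [ (λ z≼y → convex x≼z z≼y v∈x v∈y)
          -- A point `z` of the ball beyond `y` would put `y` into the ball by convexity.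
          , (λ y≼z → ⊥-elim (y∉ (Ball-convex n i x≼y y≼z bx bz))) ]′ (total z y))
        ... | inj₂ y≼x = inj₂ ((x , bx) , Sv , v∈x , λ {z} bz z≼x →
          [ (λ y≼z → convex y≼z z≼x v∈y v∈x)
          , (λ z≼y → ⊥-elim (y∉ (Ball-convex n i z≼y y≼x bz bx))) ]′ (total y z))

      -- If an inner vertex lies over `t`, then `t` is in ball `suc j` but not in ball `j`, so some
      -- `u` hitting ball `j` covers `t`. As `u` has too low a level to be inner, it takes up one
      -- place over `t`.
      atMost-inner : ∀ d → (∀ t → AtMost (suc d) (S ∩ bag t)) →
                     ∀ n j t → AtMost d (Inner n j ∩ bag t)
      atMost-inner d depth n j t with em {P = ∃ (Inner n j ∩ bag t)}
      ... | no ∄ = atMost-⊆ d (λ x∈ → ⊥-elim (∄ (_ , x∈))) (atMost-∅ d)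
      ... | yes (v , (_ , (_ , min) , inside) , v∈t) with inside t v∈t
      ... | inj₁ bt = ⊥-elim (1+n≰n (min j (t , bt , v∈t)))
      ... | inj₂ (u , Su , hit-u , u∈t) =
        atMost-⊆ d (λ ((Sw , (_ , min-w) , _) , w∈t) →
                      (Sw , w∈t) , λ { refl → 1+n≰n (min-w j hit-u) })
          (depth t u (Su , u∈t))

      Spot : ℕ → Pred V 0ℓ
      Spot n v = ∃[ i ] (Inner n i v ⊎ Cross n i v)

      locate : ∀ {v} → S v → ∃[ n ] (Root n v × Spot n v)
      locate {v} Sv
        with n , hits , n-min ← least (λ n → ∃[ i ] Hits (Ball n i) v)
               -- The ball centred at the chosen point of `v` itself shows that some code reaches
               -- `v`.
               {code v} (0 , _ , (v , Sv , refl , refl) , proj₂ (vertex-cover v))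
        with least (λ i → Hits (Ball n i) v) (proj₂ hits)
      ... | zero  , level = n , (hits , n-min) , zero , inj₂ (Sv , level , inj₁ refl)
      ... | suc j , level with em {P = ∃[ t ] (bag t v × ¬ Ball n (suc j) t)}
      ... | yes out = n , (hits , n-min) , suc j , inj₂ (Sv , level , inj₂ out)
      ... | no ¬out = n , (hits , n-min) , j ,
        inj₁ (Sv , level , λ t v∈t → decidable-stable em (λ t∉ → ¬out (t , v∈t , t∉)))

      -- A ball that hits `v` is followed by one that hits `w`; used both ways, this gives vertices
      -- with a common bag the same root.
      root-≤ : ∀ {n n′ v w t} → S v → bag t v → bag t w → Root n v → Root n′ w → n′ ≤ n
      root-≤ {n} Sv v∈t w∈t ((i , hit) , _) (_ , min) =
        min n (suc i , _ , hits-next Sv hit v∈t , w∈t)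

      level-≤ : ∀ {n i i′ v w t} → S v → bag t v → bag t w →
                Level n i v → Level n i′ w → i′ ≤ suc i
      level-≤ Sv v∈t w∈t (hit , _) (_ , min) = min _ (_ , hits-next Sv hit v∈t , w∈t)

      -- All points of `v` are in ball `suc j`, so `w` is hit there already; `level-≤` would allow
      -- one level more.
      inner-level-≤ : ∀ {n j i v w t} → Inner n j v → bag t v → bag t w →
                      Level n i w → i ≤ suc j
      inner-level-≤ (_ , _ , inside) v∈t w∈t (_ , min) = min _ (_ , inside _ v∈t , w∈t)

      module _ (d : ℕ) (depth : ∀ t → AtMost d (S ∩ bag t)) (M : IntervalModel)
               (inner : ∀ n j → Embedding bag (Inner n j) M) where
        private
          module M = IntervalModel M
          module I n j = Embedding (inner n j)
          open Layered (d + d) M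

        index : ∀ n i → Numbering (d + d) (Cross n i)
        index n i = numbering (d + d) (atMost-cross d depth n i)

        place : ∀ n {v} → Spot n v → Vertex
        place n (j , inj₁ p) = n , j , inj₁ (I.at n j p)
        place n (i , inj₂ p) = n , i , inj₂ (proj₁ (index n i) p)

        place-root : ∀ n {v} (p : Spot n v) → proj₁ (place n p) ≡ n
        place-root n (_ , inj₁ _) = refl
        place-root n (_ , inj₂ _) = refl

        place-injective : ∀ n {v w} (p : Spot n v) (q : Spot n w) →
                          place n p ≡ place n q → v ≡ w
        place-injective n (j , inj₁ p) (j′ , inj₁ q) eq
          with refl ← cong (proj₁ ∘ proj₂) eq =
          I.injective n j p q (inj₁-injective (cong (proj₂ ∘ proj₂) eq))
        place-injective n (i , inj₂ p) (i′ , inj₂ q) eq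
          with refl ← cong (proj₁ ∘ proj₂) eq =
          proj₂ (index n i) p q (inj₂-injective (cong (proj₂ ∘ proj₂) eq))

        place-meets : ∀ n {v w} (p : Spot n v) (q : Spot n w) {t} → bag t v → bag t w →
                      ∃[ u ] (layerBag u (place n p) × layerBag u (place n q))
        place-meets n (j , inj₁ p@(_ , lv , _)) (j′ , inj₁ q@(_ , lw , _)) v∈t w∈t
          -- Each inner level bounds the other, so both vertices belong to the same layer.
          with refl ← ≤-antisym (≤-pred (inner-level-≤ q w∈t v∈t lv))
                                (≤-pred (inner-level-≤ p v∈t w∈t lw)) =
          let u , p∈u , q∈u = I.meets n j p q v∈t w∈t
          in (n , j , u) , (refl , refl , p∈u) , (refl , refl , q∈u)
        place-meets n (j , inj₁ p@(_ , lv , _)) (i , inj₂ q@(Sw , lw , _)) v∈t w∈t =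
          let u , p∈u = M.vertex-cover (I.at n j p)
          in (n , j , u) , (refl , refl , p∈u) ,
             (refl , ≤-pred (level-≤ Sw w∈t v∈t lw lv) , inner-level-≤ p v∈t w∈t lw)
        place-meets n (i , inj₂ p@(Sv , lv , _)) (j , inj₁ q@(_ , lw , _)) v∈t w∈t =
          let u , q∈u = M.vertex-cover (I.at n j q)
          in (n , j , u) , (refl , ≤-pred (level-≤ Sv v∈t w∈t lv lw) , inner-level-≤ q w∈t v∈t lv) ,
             (refl , refl , q∈u)
        place-meets n (i , inj₂ p@(Sv , lv , _)) (i′ , inj₂ q@(Sw , lw , _)) v∈t w∈t
          -- The smaller of the two levels names a layer in which both vertices occur.
          with ≤-total i i′
        ... | inj₁ i≤i′ = (n , i , M.nonEmpty) , (refl , ≤-refl , n≤1+n i) ,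
                          (refl , i≤i′ , level-≤ Sv v∈t w∈t lv lw)
        ... | inj₂ i′≤i = (n , i′ , M.nonEmpty) , (refl , i′≤i , level-≤ Sw w∈t v∈t lw lv) ,
                          (refl , ≤-refl , n≤1+n i′)

        layered-embedding : Embedding bag S layered
        layered-embedding = record
          { at = at
          ; injective = λ p q eq → injective (locate p) (locate q) eq
          ; meets = λ p q v∈t w∈t → meets p q (locate p) (locate q) v∈t w∈t }
          where
          at′ : ∀ {v} → ∃[ n ] (Root n v × Spot n v) → Vertex
          at′ (n , _ , spot) = place n spot
          at : ∀ {v} → S v → Vertex
          at = at′ ∘ locate
          injective : ∀ {v w} (p : ∃[ n ] (Root n v × Spot n v))
                      (q : ∃[ n ] (Root n w × Spot n w)) → at′ p ≡ at′ q → v ≡ w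
          injective (n , _ , p) (n′ , _ , q) eq
            with refl ← trans (sym (place-root n p)) (trans (cong proj₁ eq) (place-root n′ q)) =
            place-injective n p q eq
          meets : ∀ {v w} → S v → S w → (p : ∃[ n ] (Root n v × Spot n v))
                  (q : ∃[ n ] (Root n w × Spot n w)) → ∀ {t} → bag t v → bag t w →
                  ∃[ u ] (layerBag u (at′ p) × layerBag u (at′ q))
          meets Sv Sw (n , r , p) (n′ , r′ , q) v∈t w∈t
            with refl ← ≤-antisym (root-≤ Sw w∈t v∈t r′ r) (root-≤ Sv v∈t w∈t r r′) =
            place-meets n p q v∈t w∈t

    -- At depth one, vertices of `S` with a common bag are equal, so they can be sent to isolated
    -- vertices.
    isolated-embedding : ∀ {S} → (∀ t → AtMost 1 (S ∩ bag t)) → Embedding bag S isolated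
    isolated-embedding {S} depth = record
      { at = λ {v} _ → code v
      ; injective = λ _ _ → code-injective
      ; meets = λ {v} {w} p q {t} v∈t w∈t → code v , refl ,
          cong code (sym (decidable-stable em (λ w≢v → depth t v (p , v∈t) w ((q , w∈t) , w≢v)))) }

    -- Induction with `S` arbitrary: the step passes to the inner vertices of each component and
    -- level, whose depth is one less.
    universal-embedding : ∀ k S → (∀ t → AtMost (suc k) (S ∩ bag t)) →
                          Embedding bag S (universalModel k)
    universal-embedding zero    S depth = isolated-embedding depth
    universal-embedding (suc k) S depth =
      layered-embedding (suc (suc k)) depth (universalModel k)
        (λ n j → universal-embedding k (Inner n j) (atMost-inner (suc k) depth n j))
      where open Layers S

  -- From embeddings to subgraphs

  embedding⇒contains : ∀ {G} (D : LineDecomposition G) {M} →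
                       Embedding (LineDecomposition.bag D) U M →
                       IntervalModel.graph M Contains G
  embedding⇒contains {G} D {M} E = image , f ,
    ( f-injective
    , (λ y → mk⇔ id id)) ,
    (λ v w → mk⇔ (λ v~w → v , w , v~w , refl , refl)
      λ { (v′ , w′ , v′~w′ , fv′≡fv , fw′≡fw) →
          subst₂ _~_ (f-injective fv′≡fv) (f-injective fw′≡fw) v′~w′ })
    where
    open Graph G
    open LineDecomposition D using (edge-cover)
    open Embedding E
    f : V → IntervalModel.V M
    f v = at {v} tt
    f-injective : Injective _≡_ _≡_ f
    f-injective = injective tt tt
    image : Subgraph (IntervalModel.graph M)
    image = record
      { vertex = λ y → ∃[ v ] f v ≡ y
      -- Only images of edges are kept, since the model graph may join further pairs of these
      -- vertices.
      ; edge = λ x y → ∃[ v ] ∃[ w ] (v ~ w × f v ≡ x × f w ≡ y)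
      ; edge-sym = λ (v , w , v~w , p , q) → w , v , ~-sym v~w , q , p
      ; edge⇒~ = λ { (v , w , v~w , refl , refl) →
          (λ eq → ~-irrefl (f-injective eq) v~w) ,
          (let t , v∈t , w∈t = edge-cover v~w in meets tt tt v∈t w∈t) }
      ; edge-end = λ (v , w , _ , p , q) → (v , p) , (w , q) }

theorem5 : (∀ {ℓ} → ExcludedMiddle ℓ) →
    ∀ (k : ℕ) →
    ∃[ U ] (LineWidthAtMost (4 * k ^ 2 + 6 * k) U × Universal U (ℒ k))
theorem5 em k =
  graph ,
  lineWidthAtMost em decomposition (4 * k ^ 2 + 6 * k)
    (λ t → atMost-≤ (bagBound-≤ k) (universalModel-size k t)) ,
  λ G G∈ℒ → let D , depth = lineWidthAtMost⁻¹ em k G∈ℒ in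
    embedding⇒contains em D
      (universal-embedding em D k U (λ t → atMost-⊆ (suc k) proj₂ (depth t)))
  where open IntervalModel (universalModel k)
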